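{- The problem Unique Response Roman Domination can be solved in time $\mathcal{O}(n+m)$ on split graphs, where $n$ is the number of vertices and $m$ the number of edges of the input graph.
   Context: Graphs are finite, simple and undirected. A split graph is a graph $G=(V,E)$ whose vertex set can be partitioned as $V=C\cup I$ with $C$ a clique and $I$ an independent set. A function $f:V\to\{0,1,2\}$ is a unique response Roman dominating function on $G$ if (i) every vertex $v$ with $f(v)=0$ has exactly one neighbor $u$ with $f(u)=2$, and (ii) every vertex $v$ with $f(v)\ge 1$ has no neighbor $u$ with $f(u)=2$. Its weight is $\omega(f)=\sum_{v\in V}f(v)$. Unique Response Roman Domination: given a graph $G$ and $k\in\mathbb{N}$, decide whether there is a unique response Roman dominating function $f$ on $G$ with $\omega(f)\le k$. -}

module Defs where

open import Data.Bool.Base using (Bool; true; false; if_then_else_)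
open import Data.Fin.Base using (Fin; toℕ; _<_)
open import Data.Fin.Patterns using (0F; 2F)
open import Data.Fin.Properties using (_<?_)
open import Data.Fin.Subset using (Subset; ∁) renaming (_∈_ to _∈ₛ_)
open import Data.List.Base
  using (List; []; _∷_; _++_; map; length; sum; concat; tabulate; filter;
         allFin; cartesianProduct; head; drop)
open import Data.List.Membership.Propositional using (_∈_)
open import Data.List.Relation.Unary.Unique.Propositional using (Unique)
open import Data.Maybe.Base using (Maybe; just; nothing)
open import Data.Nat.Base using (ℕ; zero; suc; _+_; _*_; _∸_; _≤_; _≡ᵇ_)
open import Data.Product.Base using (∃₂; ∃-syntax; _×_; _,_)
open import Data.Product using (∃!)
open import Data.Sum.Base using (_⊎_; inj₁; inj₂)
open import Function.Bundles using (_⇔_)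
open import Level using (0ℓ)
open import Relation.Binary.Core using (Rel)
open import Relation.Binary.Definitions
  using (Decidable; Irreflexive; Symmetric)
open import Relation.Binary.PropositionalEquality using (_≡_; _≢_)
open import Relation.Nullary.Decidable using (_×-dec_)
open import Relation.Nullary.Negation using (¬_)
open import Relation.Nullary.Reflects using (Reflects)

record Graph : Set₁ where
  field
    order  : ℕ
  Vertex : Set
  Vertex = Fin order
  field
    Adj    : Rel Vertex 0ℓ
    adj?   : Decidable Adj
    sym    : Symmetric Adj
    irrefl : Irreflexive _≡_ Adj

  -- Each edge {u , v} is counted once, as the pair with u < v.
  edges : List (Vertex × Vertex)
  edges = filter (λ { (u , v) → (u <? v) ×-dec adj? u v })
                 (cartesianProduct (allFin order) (allFin order))

  size : ℕ
  size = length edges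

module _ (G : Graph) where
  open Graph G

  IsClique : Subset order → Set
  IsClique S = ∀ u v → u ∈ₛ S → v ∈ₛ S → u ≢ v → Adj u v

  IsIndependent : Subset order → Set
  IsIndependent S = ∀ u v → u ∈ₛ S → v ∈ₛ S → ¬ Adj u v

  IsSplit : Set
  IsSplit = ∃[ C ] IsClique C × IsIndependent (∁ C)

  record IsUniqueResponseRoman (f : Vertex → Fin 3) : Set where
    field
      uniqueResponse : ∀ v → f v ≡ 0F →
                       ∃! _≡_ λ u → Adj v u × f u ≡ 2F
      noResponse     : ∀ v → 1 ≤ toℕ (f v) →
                       ¬ (∃[ u ] Adj v u × f u ≡ 2F)

  weight : (Vertex → Fin 3) → ℕ
  weight f = sum (tabulate λ v → toℕ (f v))

  UniqueResponseRomanDomination : ℕ → Set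
  UniqueResponseRomanDomination k =
    ∃[ f ] IsUniqueResponseRoman f × weight f ≤ k

-- Unit-cost random access machine, with addition and truncated
-- subtraction as its only arithmetic.  Besides the memory there is a
-- separate file of registers; a program mentions only finitely many of
-- them, and registers can only be named by constants in the program.

Reg : Set
Reg = ℕ

Label : Set
Label = ℕ

data Instr : Set where
  const : Reg → ℕ → Instr            -- r ← c
  add   : Reg → Reg → Reg → Instr    -- r ← s + t
  sub   : Reg → Reg → Reg → Instr    -- r ← s ∸ t
  load  : Reg → Reg → Instr          -- r ← M[s]
  store : Reg → Reg → Instr          -- M[r] ← s
  jump  : Label → Instr
  jzero : Reg → Label → Instr        -- jump if r is zero
  halt  : Bool → Instr

Program : Set
Program = List Instr

record State : Set where
  constructor ⟨_,_,_⟩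
  field
    pc   : Label
    regs : Reg → ℕ
    mem  : ℕ → ℕ

_[_≔_] : (ℕ → ℕ) → ℕ → ℕ → ℕ → ℕ
(f [ i ≔ x ]) j = if j ≡ᵇ i then x else f j

exec : Instr → State → State ⊎ Bool
exec (const r c) ⟨ p , R , M ⟩ = inj₁ ⟨ suc p , R [ r ≔ c ] , M ⟩
exec (add r s t) ⟨ p , R , M ⟩ = inj₁ ⟨ suc p , R [ r ≔ R s + R t ] , M ⟩
exec (sub r s t) ⟨ p , R , M ⟩ = inj₁ ⟨ suc p , R [ r ≔ R s ∸ R t ] , M ⟩
exec (load r s)  ⟨ p , R , M ⟩ = inj₁ ⟨ suc p , R [ r ≔ M (R s) ] , M ⟩
exec (store r s) ⟨ p , R , M ⟩ = inj₁ ⟨ suc p , R , M [ R r ≔ R s ] ⟩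
exec (jump l)    ⟨ p , R , M ⟩ = inj₁ ⟨ l , R , M ⟩
exec (jzero r l) ⟨ p , R , M ⟩ =
  inj₁ ⟨ (if R r ≡ᵇ 0 then l else suc p) , R , M ⟩
exec (halt b)    _             = inj₂ b

fetch : Program → Label → Maybe Instr
fetch P p = head (drop p P)

-- run P t s ≡ just b  iff  P, started in s, executes halt b within t
-- steps.  Leaving the program text is a crash, not a halt.
run : Program → ℕ → State → Maybe Bool
run P zero    s = nothing
run P (suc t) s with fetch P (State.pc s)
... | nothing = nothing
... | just i with exec i s
...   | inj₁ s′ = run P t s′
...   | inj₂ b  = just b

-- The neighbours of a vertex are listed without repetition, in an
-- arbitrary order.
record AdjacencyLists (G : Graph) : Set where
  open Graph G
  field
    nbrs     : Vertex → List Vertex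
    unique   : ∀ v → Unique (nbrs v)
    complete : ∀ v u → u ∈ nbrs v ⇔ Adj v u

offsets : {A : Set} → ℕ → List (List A) → List ℕ
offsets a []         = a ∷ []
offsets a (xs ∷ xss) = a ∷ offsets (a + length xs) xss

-- Memory layout, for n = order G:
--   M[0] = n,  M[1] = k,
--   M[2 + v] = address at which the list of vertex v starts (v < n),
--   M[2 + n] = address just past the last list,
--   from address 3 + n on: the lists of vertices 0, 1, …, n - 1,
--   one after the other.
encode : (G : Graph) → AdjacencyLists G → ℕ → List ℕ
encode G L k =
  order ∷ k ∷ offsets (3 + order) lists ++ map toℕ (concat lists)
  where
  open Graph G
  lists : List (List Vertex)
  lists = tabulate (AdjacencyLists.nbrs L)

memory : List ℕ → ℕ → ℕ
memory []       _       = 0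
memory (x ∷ _)  zero    = x
memory (_ ∷ xs) (suc a) = memory xs a

initial : List ℕ → State
initial xs = ⟨ 0 , (λ _ → 0) , memory xs ⟩

-- One program and one constant serve all graphs in the class, all
-- parameters k and all adjacency-list presentations.  The successor in
-- the bound only matters when T G = 0, e.g. for the empty graph, on
-- which a program still needs at least one step.
SolvableInTimeO : (Graph → ℕ → Set) → (Graph → Set) → (Graph → ℕ) → Set₁
SolvableInTimeO Problem Class T =
  ∃₂ λ (P : Program) (c : ℕ) →
  ∀ (G : Graph) → Class G → ∀ (L : AdjacencyLists G) (k : ℕ) →
  ∃[ b ] run P (c * suc (T G)) (initial (encode G L k)) ≡ just b
       × Reflects (Problem G k) b

{-# OPTIONS --safe #-}
-- On a split graph of maximum degree Δ the minimum weight is n ∸ (Δ ∸ 1).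
-- Value 2 on a single vertex v, 0 on its neighbours and 1 elsewhere gives
-- weight n + 1 ∸ deg v.  Conversely let a function have a zero x, answered
-- by a vertex u of value 2: comparing the function vertex by vertex with
-- the degree indicator of u (if u lies in the clique) or of x (otherwise)
-- shows that no smaller weight than n + 1 ∸ deg is possible.  Without a
-- zero the weight is at least n.  The answer is therefore yes iff n ≤ k or
-- n ∸ k < deg v for some v, and the degrees are differences of consecutive
-- offsets, so one scan of the offset table decides it.

module Submission where

open import Defs
open import Data.Bool.Base using (true; false)
open import Data.Fin.Base using (Fin; zero; suc; toℕ)
open import Data.Fin.Patterns using (0F; 1F; 2F)
open import Data.Fin.Properties using (_≟_; any?)
open import Data.Fin.Subset using (Subset; ∁) renaming (_∈_ to _∈ₛ_; _∉_ to _∉ₛ_)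
open import Data.Fin.Subset.Properties using (_∈?_; x∉p⇒x∈∁p)
open import Data.List.Base
  using (List; []; _∷_; _++_; length; tabulate; filter; allFin)
open import Data.List.Membership.Propositional.Properties
  using (∈-allFin; ∈-filter⁺; ∈-filter⁻)
open import Data.List.Membership.Propositional.Properties.WithK
  using (unique∧set⇒bag)
open import Data.List.Relation.Binary.BagAndSetEquality using (∼bag⇒↭)
open import Data.List.Relation.Binary.Permutation.Propositional.Properties
  using (↭-length)
open import Data.List.Relation.Unary.Unique.Propositional.Properties
  using (allFin⁺; filter⁺)
open import Data.Maybe.Base using (just)
open import Data.Nat.Base
open import Data.Nat.ListAction using (sum)
open import Data.Nat.Properties
  using (≤-trans; m≤m+n; m≤n+m; +-mono-≤; +-monoˡ-≤;
         +-comm; +-suc; +-cancelʳ-≤;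
         +-∸-assoc; m≤n+o⇒m∸n≤o; m≤n+m∸n; m∸n≡0⇒m≤n; m≤n⇒m∸n≡0;
         m∸n≢0⇒n<m; m+n∸m≡n; <⇒≤; ≰⇒>; <⇒≱; _≤?_; +-monoʳ-≤;
         +-commutativeSemigroup; 1+n≢0; module ≤-Reasoning)
open import Data.Nat.Tactic.RingSolver using (solve-∀)
open import Algebra.Properties.CommutativeSemigroup +-commutativeSemigroup
  using (interchange)
open import Data.Product.Base using (∃-syntax; _×_; _,_; proj₂)
open import Data.Sum.Base as Sum using (_⊎_; inj₁; inj₂)
open import Function.Base using (_∘_; id)
open import Function.Bundles using (_⇔_; mk⇔; Equivalence)
open import Relation.Binary.PropositionalEquality
open import Relation.Nullary.Decidable using (Dec; yes; no)
open import Relation.Nullary.Negation using (¬_; contradiction)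
open import Relation.Nullary.Reflects using (Reflects; ofʸ; ofⁿ)

Reflects-resp-⇔ : ∀ {A B : Set} {b} → A ⇔ B → Reflects A b → Reflects B b
Reflects-resp-⇔ A⇔B (ofʸ a)  = ofʸ (Equivalence.to A⇔B a)
Reflects-resp-⇔ A⇔B (ofⁿ ¬a) = ofⁿ (¬a ∘ Equivalence.from A⇔B)

-- Finite sums and indicators.

∑ : ∀ {n} → (Fin n → ℕ) → ℕ
∑ f = sum (tabulate f)

∑-mono-≤ : ∀ {n} {f g : Fin n → ℕ} → (∀ i → f i ≤ g i) → ∑ f ≤ ∑ g
∑-mono-≤ {zero}  f≤g = z≤n
∑-mono-≤ {suc n} f≤g = +-mono-≤ (f≤g zero) (∑-mono-≤ (f≤g ∘ suc))

∑-cong : ∀ {n} {f g : Fin n → ℕ} → (∀ i → f i ≡ g i) → ∑ f ≡ ∑ g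
∑-cong {zero}  f≗g = refl
∑-cong {suc n} f≗g = cong₂ _+_ (f≗g zero) (∑-cong (f≗g ∘ suc))

∑-+ : ∀ {n} (f g : Fin n → ℕ) → ∑ (λ i → f i + g i) ≡ ∑ f + ∑ g
∑-+ {zero}  f g = refl
∑-+ {suc n} f g = trans (cong (f zero + g zero +_) (∑-+ (f ∘ suc) (g ∘ suc)))
                        (interchange (f zero) (g zero) _ _)

∑-1 : ∀ n → ∑ {n} (λ _ → 1) ≡ n
∑-1 zero    = refl
∑-1 (suc n) = cong suc (∑-1 n)

∑-suc : ∀ {n} (f : Fin n → ℕ) → ∑ (λ i → suc (f i)) ≡ n + ∑ f
∑-suc {n} f = trans (∑-+ (λ _ → 1) f) (cong (_+ ∑ f) (∑-1 n))

𝟙 : {A : Set} → Dec A → ℕ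
𝟙 (yes _) = 1
𝟙 (no _)  = 0

length-filter-tabulate : ∀ {A : Set} {P : A → Set} (P? : ∀ a → Dec (P a))
                         {n} (f : Fin n → A) →
                         length (filter P? (tabulate f)) ≡ ∑ (𝟙 ∘ P? ∘ f)
length-filter-tabulate P? {zero}  f = refl
length-filter-tabulate P? {suc n} f with P? (f zero)
... | yes _ = cong suc (length-filter-tabulate P? (f ∘ suc))
... | no  _ = length-filter-tabulate P? (f ∘ suc)

∑-0 : ∀ n → ∑ {n} (λ _ → 0) ≡ 0
∑-0 zero    = refl
∑-0 (suc n) = ∑-0 n

∑-δ : ∀ {n} (i : Fin n) → ∑ (λ j → 𝟙 (i ≟ j)) ≡ 1
∑-δ {suc n} zero    = cong suc (∑-0 n)
∑-δ {suc n} (suc i) = trans (∑-cong δ-suc) (∑-δ i)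
  where
  δ-suc : ∀ j → 𝟙 (suc i ≟ suc j) ≡ 𝟙 (i ≟ j)
  δ-suc j with i ≟ j
  ... | yes _ = refl
  ... | no  _ = refl

≢0F⇒1≤toℕ : ∀ {n} {i : Fin (suc n)} → i ≢ 0F → 1 ≤ toℕ i
≢0F⇒1≤toℕ {i = zero}  i≢0 = contradiction refl i≢0
≢0F⇒1≤toℕ {i = suc i} i≢0 = s≤s z≤n

-- Degrees and the weight of response functions.

module _ (G : Graph) where
  open Graph G renaming (sym to adj-sym)

  degree : Vertex → ℕ
  degree v = ∑ (λ u → 𝟙 (adj? v u))

  -- Two repetition-free lists with the same members are permutations of each other; the second list
  -- here is `allFin order` filtered by adjacency.
  length-nbrs : (L : AdjacencyLists G) → ∀ v →
                length (AdjacencyLists.nbrs L v) ≡ degree v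
  length-nbrs L v = trans
    (↭-length (∼bag⇒↭ (unique∧set⇒bag (unique v)
      (filter⁺ (adj? v) (allFin⁺ order))
      λ {u} → mk⇔
        (∈-filter⁺ (adj? v) (∈-allFin u) ∘ Equivalence.to (complete v u))
        (Equivalence.from (complete v u) ∘ proj₂ ∘
          ∈-filter⁻ (adj? v) {xs = allFin order}))))
    (length-filter-tabulate (adj? v) id)
    where open AdjacencyLists L

  -- Upper bound: the star function of a vertex.

  module _ (v : Vertex) where

    star : Vertex → Fin 3
    star y with v ≟ y | adj? v y
    ... | yes _ | _     = 2F
    ... | no  _ | yes _ = 0F
    ... | no  _ | no  _ = 1F

    star≡0⇒Adj : ∀ y → star y ≡ 0F → Adj v y
    star≡0⇒Adj y eq with v ≟ y | adj? v y
    ... | no _ | yes vy = vy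

    star≡2⇒≡ : ∀ y → star y ≡ 2F → v ≡ y
    star≡2⇒≡ y eq with v ≟ y | adj? v y
    ... | yes v≡y | _ = v≡y
    ... | no  _ | yes _ with () ← eq
    ... | no  _ | no  _ with () ← eq

    star-centre : star v ≡ 2F
    star-centre with v ≟ v | adj? v v
    ... | yes _  | _ = refl
    ... | no v≢v | _ = contradiction refl v≢v

    Adj⇒star≡0 : ∀ y → Adj v y → star y ≡ 0F
    Adj⇒star≡0 y vy with v ≟ y | adj? v y
    ... | yes v≡y | _      = contradiction vy (irrefl v≡y)
    ... | no  _   | yes _  = refl
    ... | no  _   | no ¬vy = contradiction vy ¬vy

    star-isUniqueResponseRoman : IsUniqueResponseRoman G star
    star-isUniqueResponseRoman = record
      { uniqueResponse = λ y y≡0 →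
          v , (adj-sym (star≡0⇒Adj y y≡0) , star-centre) ,
          λ { (_ , u≡2) → star≡2⇒≡ _ u≡2 }
      ; noResponse = λ { y 1≤y (u , yu , u≡2) →
          contradiction
            (subst (1 ≤_) (cong toℕ (Adj⇒star≡0 y
              (adj-sym (subst (Adj y) (sym (star≡2⇒≡ u u≡2)) yu)))) 1≤y)
            λ () }
      }

    -- Value plus adjacency indicator is 1 at every vertex except `v`, where it is 2.
    weight-star : weight G star + degree v ≡ suc order
    weight-star = begin
      weight G star + degree v               ≡⟨ ∑-+ (toℕ ∘ star) _ ⟨
      ∑ (λ y → toℕ (star y) + 𝟙 (adj? v y))  ≡⟨ ∑-cong pointwise ⟩
      ∑ (λ y → suc (𝟙 (v ≟ y)))              ≡⟨ ∑-suc (λ y → 𝟙 (v ≟ y)) ⟩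
      order + ∑ (λ y → 𝟙 (v ≟ y))            ≡⟨ cong (order +_) (∑-δ v) ⟩
      order + 1                              ≡⟨ +-comm order 1 ⟩
      suc order                              ∎
      where
      open ≡-Reasoning
      pointwise : ∀ y → toℕ (star y) + 𝟙 (adj? v y) ≡ suc (𝟙 (v ≟ y))
      pointwise y with v ≟ y | adj? v y
      ... | yes v≡y | yes vy = contradiction vy (irrefl v≡y)
      ... | yes _   | no  _  = refl
      ... | no  _   | yes _  = refl
      ... | no  _   | no  _  = refl

  const1-isUniqueResponseRoman : IsUniqueResponseRoman G (λ _ → 1F)
  const1-isUniqueResponseRoman = record
    { uniqueResponse = λ _ ()
    ; noResponse     = λ { _ _ (_ , _ , ()) }
    }

  -- Lower bound on split graphs.

  module _ {f : Vertex → Fin 3} (f-urr : IsUniqueResponseRoman G f)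
           {C : Subset order} (clique : IsClique G C)
           (independent : IsIndependent G (∁ C)) where
    open IsUniqueResponseRoman f-urr

    nbr-∉C : ∀ {u v} → u ∉ₛ C → Adj u v → v ∈ₛ C
    nbr-∉C {u} {v} u∉C uv with v ∈? C
    ... | yes v∈C = v∈C
    ... | no  v∉C = contradiction uv
                      (independent u v (x∉p⇒x∈∁p u∉C) (x∉p⇒x∈∁p v∉C))

    zero-∉C : ∀ {y} → f y ≡ 0F → y ∉ₛ C →
              ∃[ u ] u ∈ₛ C × Adj y u × f u ≡ 2F
    zero-∉C y≡0 y∉C with u , (yu , u≡2) , _ ← uniqueResponse _ y≡0 =
      u , nbr-∉C y∉C yu , yu , u≡2

    -- A value 2 in the clique is the only one there, so its vertex
    -- responds to every zero.
    weight-2∈C : ∀ {c} → c ∈ₛ C → f c ≡ 2F → suc order ≤ weight G f + degree c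
    weight-2∈C {c} c∈C c≡2 = begin
      suc order                           ≡⟨ +-comm order 1 ⟨
      order + 1                           ≡⟨ cong (order +_) (∑-δ c) ⟨
      order + ∑ (λ y → 𝟙 (c ≟ y))         ≡⟨ ∑-suc (λ y → 𝟙 (c ≟ y)) ⟨
      ∑ (λ y → suc (𝟙 (c ≟ y)))           ≤⟨ ∑-mono-≤ pointwise ⟩
      ∑ (λ y → toℕ (f y) + 𝟙 (adj? c y))  ≡⟨ ∑-+ (toℕ ∘ f) _ ⟩
      weight G f + degree c               ∎
      where
      open ≤-Reasoning
      zero⇒Adj : ∀ {y} → c ≢ y → f y ≡ 0F → Adj c y
      zero⇒Adj {y} c≢y y≡0 with y ∈? C
      ... | yes y∈C = clique c y c∈C y∈C c≢y
      -- The responder `u` must be `c`: otherwise the clique makes it a neighbour of `c` with value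
      -- 2, against `noResponse`.
      ... | no  y∉C with u , u∈C , yu , u≡2 ← zero-∉C y≡0 y∉C | c ≟ u
      ...   | yes refl = adj-sym yu
      ...   | no  c≢u  = contradiction (u , clique c u c∈C u∈C c≢u , u≡2)
                           (noResponse c (subst (λ i → 1 ≤ toℕ i) (sym c≡2) (s≤s z≤n)))

      pointwise : ∀ y → suc (𝟙 (c ≟ y)) ≤ toℕ (f y) + 𝟙 (adj? c y)
      pointwise y with c ≟ y | adj? c y
      ... | yes refl | _     rewrite c≡2 = s≤s (s≤s z≤n)
      ... | no _   | yes _   = m≤n+m 1 _
      ... | no c≢y | no ¬cy = ≤-trans (≢0F⇒1≤toℕ (¬cy ∘ zero⇒Adj c≢y)) (m≤m+n _ 0)

    -- The zero x is then a clique vertex whose responding vertex u lies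
    -- outside C, so no vertex of C has value 2 and hence the zeros are
    -- all in C.
    weight-2∉C : ∀ {x u} → f x ≡ 0F → Adj x u → f u ≡ 2F → u ∉ₛ C →
                 suc order ≤ weight G f + degree x
    -- At `x` both value and adjacency indicator vanish, so the indicator of `x` is added on the
    -- right. The surplus at `u`, where 2 + 1 = 3, pays for it and for the successor.
    weight-2∉C {x} {u} x≡0 xu u≡2 u∉C = +-cancelʳ-≤ 1 _ _ (begin
      suc order + 1
        ≡⟨ +-suc order 1 ⟨
      order + 2
        ≡⟨ cong (order +_) (cong₂ _+_ (∑-δ u) (∑-δ u)) ⟨
      order + (∑ (λ y → 𝟙 (u ≟ y)) + ∑ (λ y → 𝟙 (u ≟ y)))
        ≡⟨ cong (order +_) (∑-+ (λ y → 𝟙 (u ≟ y)) _) ⟨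
      order + ∑ (λ y → 𝟙 (u ≟ y) + 𝟙 (u ≟ y))
        ≡⟨ ∑-suc (λ y → 𝟙 (u ≟ y) + 𝟙 (u ≟ y)) ⟨
      ∑ (λ y → suc (𝟙 (u ≟ y) + 𝟙 (u ≟ y)))
        ≤⟨ ∑-mono-≤ pointwise ⟩
      ∑ (λ y → toℕ (f y) + 𝟙 (adj? x y) + 𝟙 (x ≟ y))
        ≡⟨ ∑-+ (λ y → toℕ (f y) + 𝟙 (adj? x y)) _ ⟩
      ∑ (λ y → toℕ (f y) + 𝟙 (adj? x y)) + ∑ (λ y → 𝟙 (x ≟ y))
        ≡⟨ cong₂ _+_ (∑-+ (toℕ ∘ f) _) (∑-δ x) ⟩
      weight G f + degree x + 1
        ∎)
      where
      open ≤-Reasoning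
      x∈C : x ∈ₛ C
      x∈C = nbr-∉C u∉C (adj-sym xu)

      zero⇒Adj : ∀ {y} → x ≢ y → f y ≡ 0F → Adj x y
      zero⇒Adj {y} x≢y y≡0 with y ∈? C
      ... | yes y∈C = clique x y x∈C y∈C x≢y
      -- As a clique vertex of value 2, `w` differs from the zero `x` and hence responds to it as
      -- well; uniqueness then gives `w ≡ u`, but `u` is outside `C`.
      ... | no  y∉C with w , w∈C , _ , w≡2 ← zero-∉C y≡0 y∉C | x ≟ w
      ...   | yes refl = contradiction (trans (sym x≡0) w≡2) λ ()
      ...   | no  x≢w
        with _ , _ , unique ← uniqueResponse x x≡0 =
        contradiction (subst (_∈ₛ C) w≡u w∈C) u∉C
        where
        w≡u : w ≡ u
        w≡u = trans (sym (unique (clique x w x∈C w∈C x≢w , w≡2)))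
                    (unique (xu , u≡2))

      pointwise : ∀ y → suc (𝟙 (u ≟ y) + 𝟙 (u ≟ y)) ≤
                        toℕ (f y) + 𝟙 (adj? x y) + 𝟙 (x ≟ y)
      pointwise y with u ≟ y | x ≟ y | adj? x y
      ... | yes refl | _      | no ¬xu = contradiction xu ¬xu
      ... | yes refl | _      | yes _  rewrite u≡2 = m≤m+n 3 _
      ... | no _     | yes _  | _      = m≤n+m 1 _
      ... | no _     | no _   | yes _  = ≤-trans (m≤n+m 1 _) (m≤m+n _ 0)
      ... | no _     | no x≢y | no ¬xy =
        ≤-trans (≢0F⇒1≤toℕ (¬xy ∘ zero⇒Adj x≢y)) (≤-trans (m≤m+n _ 0) (m≤m+n _ 0))

    weight-bound : order ≤ weight G f ⊎ ∃[ v ] suc order ≤ weight G f + degree v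
    weight-bound with any? (λ x → f x ≟ 0F)
    ... | no no-zero = inj₁ (subst (_≤ weight G f) (∑-1 order)
                              (∑-mono-≤ λ y → ≢0F⇒1≤toℕ λ y≡0 → no-zero (y , y≡0)))
    ... | yes (x , x≡0) with u , (xu , u≡2) , _ ← uniqueResponse x x≡0 | u ∈? C
    ...   | yes u∈C = inj₂ (u , weight-2∈C u∈C u≡2)
    ...   | no  u∉C = inj₂ (x , weight-2∉C x≡0 xu u≡2 u∉C)

  -- The left side is the form that the machine tests: either the constant function 1 is light
  -- enough, or some star is.
  urrd⇔degree : IsSplit G → ∀ k →
    (order ∸ k ≡ 0 ⊎ ∃[ v ] order ∸ k < degree v) ⇔ UniqueResponseRomanDomination G k
  urrd⇔degree (C , clique , independent) k = mk⇔ to from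
    where
    to : order ∸ k ≡ 0 ⊎ (∃[ v ] order ∸ k < degree v) → UniqueResponseRomanDomination G k
    to (inj₁ n∸k≡0) = (λ _ → 1F) , const1-isUniqueResponseRoman ,
                      subst (_≤ k) (sym (∑-1 order)) (m∸n≡0⇒m≤n n∸k≡0)
    to (inj₂ (v , n∸k<deg)) = star v , star-isUniqueResponseRoman v ,
      +-cancelʳ-≤ (degree v) _ _ (begin
        weight G (star v) + degree v  ≡⟨ weight-star v ⟩
        suc order                     ≤⟨ s≤s (m≤n+m∸n order k) ⟩
        suc (k + (order ∸ k))         ≡⟨ +-suc k _ ⟨
        k + suc (order ∸ k)           ≤⟨ +-monoʳ-≤ k n∸k<deg ⟩
        k + degree v                  ∎)
      where open ≤-Reasoning

    from : UniqueResponseRomanDomination G k → order ∸ k ≡ 0 ⊎ ∃[ v ] order ∸ k < degree v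
    from (f , f-urr , w≤k) with weight-bound f-urr clique independent
    ... | inj₁ n≤w = inj₁ (m≤n⇒m∸n≡0 (≤-trans n≤w w≤k))
    -- Truncated subtraction of `k` commutes with the successor only for `k ≤ order`; the other case
    -- falls under the first disjunct.
    ... | inj₂ (v , n<w+deg) with order ≤? k
    ...   | yes n≤k = inj₁ (m≤n⇒m∸n≡0 n≤k)
    ...   | no  n≰k = inj₂ (v , subst (_≤ degree v) (+-∸-assoc 1 (<⇒≤ (≰⇒> n≰k)))
                        (m≤n+o⇒m∸n≤o (suc order) k
                          (≤-trans n<w+deg (+-monoˡ-≤ (degree v) w≤k))))

-- Degrees as gaps in the offset table.

gap : (ℕ → ℕ) → ℕ → ℕ
gap M p = M (suc p) ∸ M p

memory-offsets-head : ∀ {A : Set} a (xss : List (List A)) ys →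
                      memory (offsets a xss ++ ys) 0 ≡ a
memory-offsets-head a []        ys = refl
memory-offsets-head a (_ ∷ xss) ys = refl

gap-offsets : ∀ {A : Set} {n} a (f : Fin n → List A) ys i →
              gap (memory (offsets a (tabulate f) ++ ys)) (toℕ i) ≡ length (f i)
gap-offsets a f ys zero =
  trans (cong (_∸ a) (memory-offsets-head _ (tabulate (f ∘ suc)) ys))
        (m+n∸m≡n a (length (f zero)))
gap-offsets a f ys (suc i) = gap-offsets (a + length (f zero)) (f ∘ suc) ys i

-- Register 2 counts the vertices still to be scanned, register 3 points
-- to the offset of the next one, and register 4 holds n ∸ k.
program : Program
program =
  -- Register 0 keeps its initial 0, so this reads `n`. Register 1 holds 1, both as the address of
  -- `k` and as the increment.
  load  2 0   ∷
  const 1 1   ∷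
  load  4 1   ∷
  sub   4 2 4 ∷
  const 3 2   ∷
  jzero 4 14  ∷
  jzero 2 15  ∷
  load  5 3   ∷
  add   3 1 3 ∷
  load  6 3   ∷
  sub   6 6 5 ∷
  sub   6 6 4 ∷
  sub   2 2 1 ∷
  jzero 6 6   ∷
  halt true   ∷
  halt false  ∷ []

-- Correctness and running time of the program.

infix 1 _Halts[_]⊢_
_Halts[_]⊢_ : State → ℕ → Set → Set
s Halts[ t ]⊢ Q = ∃[ b ] run program t s ≡ just b × Reflects Q b

-- The updates stand in execution order, uncollapsed, to agree with the evaluated round. Register 6
-- ends at 0 because the loop is re-entered only then.
nextRegs : (ℕ → ℕ) → ℕ → (Reg → ℕ) → Reg → ℕ
nextRegs M p R =
  (((((R [ 5 ≔ M p ]) [ 3 ≔ suc p ]) [ 6 ≔ M (suc p) ]) [ 6 ≔ gap M p ]) [ 6 ≔ 0 ]) [ 2 ≔ R 2 ∸ 1 ]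

-- Label 6 is the head of the loop, one round of which takes 8 steps.
loop : ∀ M d i p R t → R 1 ≡ 1 → R 2 ≡ i → R 3 ≡ p → R 4 ≡ d →
       ⟨ 6 , R , M ⟩ Halts[ 2 + (i * 8 + t) ]⊢
         ∃[ j ] d < gap M (toℕ {i} j + p)
loop M d zero    p R t R1 R2 R3 R4 rewrite R2 = false , refl , ofⁿ λ ()
loop M d (suc i) p R t R1 R2 R3 R4
  rewrite R2 | R1 | R3 | R4 with gap M p ∸ d in eq
... | suc _ = true , refl , ofʸ (zero , m∸n≢0⇒n<m (λ ≡0 → 1+n≢0 (trans (sym eq) ≡0)))
... | zero
  with b , halts , reflects ← loop M d i (suc p) (nextRegs M p R) t R1 (cong (_∸ 1) R2) refl R4 =
  b , halts , Reflects-resp-⇔ (mk⇔ later now-or-later) reflects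
  where
  later : ∃[ j ] d < gap M (toℕ {i} j + suc p) → ∃[ j ] d < gap M (toℕ {suc i} j + p)
  later (j , d<gap) = suc j , subst (λ q → d < gap M q) (+-suc (toℕ j) p) d<gap

  now-or-later : ∃[ j ] d < gap M (toℕ {suc i} j + p) → ∃[ j ] d < gap M (toℕ {i} j + suc p)
  now-or-later (zero  , d<gap) = contradiction (m∸n≡0⇒m≤n eq) (<⇒≱ d<gap)
  now-or-later (suc j , d<gap) = j , subst (λ q → d < gap M q) (sym (+-suc (toℕ j) p)) d<gap

loopRegs : (n k d : ℕ) → Reg → ℕ
loopRegs n k d =
  (((((λ _ → 0) [ 2 ≔ n ]) [ 1 ≔ 1 ]) [ 4 ≔ k ]) [ 4 ≔ d ]) [ 3 ≔ 2 ]

-- Six steps of setup and two for leaving the loop account for the 8 beyond the rounds; `t` is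
-- slack.
program-halts : ∀ M t →
  ⟨ 0 , (λ _ → 0) , M ⟩ Halts[ suc (M 0) * 8 + t ]⊢
    (M 0 ∸ M 1 ≡ 0 ⊎ ∃[ j ] M 0 ∸ M 1 < gap M (toℕ {M 0} j + 2))
program-halts M t with M 0 ∸ M 1 in eq
... | zero = true , refl , ofʸ (inj₁ refl)
... | suc d
  with b , halts , reflects ← loop M (suc d) (M 0) 2 (loopRegs (M 0) (M 1) (suc d)) t refl refl refl refl =
  b , halts , Reflects-resp-⇔ (mk⇔ inj₂ λ { (inj₁ ()) ; (inj₂ j) → j }) reflects

corollary1 : SolvableInTimeO UniqueResponseRomanDomination IsSplit (λ G → Graph.order G + Graph.size G)
corollary1 = program , 8 , solves
  where
  solves : ∀ G → IsSplit G → ∀ L k →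
           ∃[ b ] run program (8 * suc (Graph.order G + Graph.size G)) (initial (encode G L k)) ≡ just b
                × Reflects (UniqueResponseRomanDomination G k) b
  solves G split L k
    -- The scan is linear in `order`; the edge part of the bound enters as slack.
    with b , halts , reflects ← program-halts (memory (encode G L k)) (Graph.size G * 8) =
    b , trans (cong (λ t → run program t (initial (encode G L k))) (fuel (Graph.order G) (Graph.size G))) halts ,
    Reflects-resp-⇔ (urrd⇔degree G split k) (Reflects-resp-⇔ gap⇔degree reflects)
    where
    open Graph G using (order; size)

    fuel : ∀ n m → 8 * suc (n + m) ≡ suc n * 8 + m * 8
    fuel = solve-∀

    gap≡degree : ∀ v → gap (memory (encode G L k)) (toℕ v + 2) ≡ degree G v
    -- With the 2 in front, the cells of `n` and `k` before the offset table are skipped by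
    -- computation.
    gap≡degree v = trans (cong (gap (memory (encode G L k))) (+-comm (toℕ v) 2))
                         (trans (gap-offsets (3 + order) (AdjacencyLists.nbrs L) _ v)
                                (length-nbrs G L v))

    gap⇔degree :
      (order ∸ k ≡ 0 ⊎ ∃[ v ] order ∸ k < gap (memory (encode G L k)) (toℕ {order} v + 2)) ⇔
      (order ∸ k ≡ 0 ⊎ ∃[ v ] order ∸ k < degree G v)
    gap⇔degree = mk⇔
      (Sum.map₂ λ (v , lt) → v , subst (order ∸ k <_) (gap≡degree v) lt)
      (Sum.map₂ λ (v , lt) → v , subst (order ∸ k <_) (sym (gap≡degree v)) lt)
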